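{- Let $D=(V,A)$ be a finite connected directed acyclic graph, and let $M$ be the coefficient matrix, with columns indexed by the variables $k$ and $f(v)$ ($v\in V$), of the system of constraints $$\sum_{w\in N(v)}f(w)-\sum_{w\in N(u)}f(w)\ge 1\quad\text{for all }(u,v)\in A,\qquad\qquad k-f(v)\ge 0\quad\text{for all }v\in V$$ (one row per constraint). Then $M$ is totally unimodular if and only if the undirected underlying graph $G(D)$ of $D$ is a complete graph.
   Context: For a directed acyclic graph $D=(V,A)$, $G(D)$ denotes its undirected underlying graph and $N(v)$ denotes the set of neighbors of $v$ in $G(D)$ (both in- and out-neighbors). Thus the row of $M$ for an arc $(u,v)$ has coefficient $[x\in N(v)]-[x\in N(u)]$ in the column of $f(x)$ (where $[\cdot]$ is $1$ if the condition holds and $0$ otherwise) and $0$ in the column of $k$; the row of $M$ for a vertex $v$ has $1$ in the column of $k$, $-1$ in the column of $f(v)$, and $0$ elsewhere. A matrix is totally unimodular if every square submatrix has determinant in $\{ -1,0,1\}$. -}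

module Defs where

open import Level using (0ℓ)
open import Data.Nat.Base using (ℕ; zero; suc)
open import Data.Integer.Base using (ℤ; 0ℤ; 1ℤ; -1ℤ; _*_; _-_; -_; _^_)
open import Data.Integer.Properties using (+-0-commutativeMonoid)
open import Data.Bool.Base using (if_then_else_)
open import Data.Fin.Base using (Fin; zero; suc; toℕ; punchIn)
open import Data.Fin.Properties using (_≟_)
open import Data.Sum.Base using (_⊎_; inj₁; inj₂; [_,_])
open import Function.Definitions using (Injective)
open import Relation.Nullary.Negation using (¬_)
open import Relation.Nullary.Decidable using (Dec; does; map′; _⊎-dec_)
open import Relation.Binary.Core using (Rel)
open import Relation.Binary.Definitions using (Decidable)
open import Relation.Binary.PropositionalEquality.Core using (_≡_; _≢_)
open import Relation.Binary.Construct.Closure.Symmetric using (SymClosure; fwd; bwd)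
open import Relation.Binary.Construct.Closure.Transitive using (TransClosure)
open import Relation.Binary.Construct.Closure.ReflexiveTransitive using (Star)
open import Algebra.Properties.CommutativeMonoid.Sum +-0-commutativeMonoid using (sum)

Matrix : Set → Set → Set
Matrix R C = R → C → ℤ

-- Laplace expansion along the first row.
det : ∀ {n} → Matrix (Fin n) (Fin n) → ℤ
det {zero}  M = 1ℤ
det {suc n} M =
  sum λ j → -1ℤ ^ toℕ j * M zero j * det (λ i l → M (suc i) (punchIn j l))

-- The index types need not be ordered, so a square submatrix is given by
-- injective enumerations of its rows and columns; reordering either one only
-- affects the sign of the determinant.
TotallyUnimodular : ∀ {R C} → Matrix R C → Set
TotallyUnimodular {R} {C} M =
  ∀ m (r : Fin m → R) (c : Fin m → C) →
  Injective _≡_ _≡_ r → Injective _≡_ _≡_ c →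
  let d = det (λ i j → M (r i) (c j)) in
  d ≡ -1ℤ ⊎ d ≡ 0ℤ ⊎ d ≡ 1ℤ

record DAG (n : ℕ) : Set₁ where
  infix 4 _⟶_ _⟶?_ _∼_ _∼?_
  field
    _⟶_     : Rel (Fin n) 0ℓ
    _⟶?_    : Decidable _⟶_
    acyclic : ∀ v → ¬ TransClosure _⟶_ v v

  -- The membership proof is irrelevant, so that arcs form a set of pairs
  -- and every arc gives exactly one row of the matrix.
  record Arc : Set where
    constructor arc
    eta-equality
    field
      tail head : Fin n
      .isArc    : tail ⟶ head

  -- Adjacency in the underlying undirected graph; u ∼ v says v ∈ N(u).
  _∼_ : Rel (Fin n) 0ℓ
  _∼_ = SymClosure _⟶_

  _∼?_ : Decidable _∼_
  u ∼? v = map′ [ fwd , bwd ]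
                (λ { (fwd p) → inj₁ p ; (bwd p) → inj₂ p })
                ((u ⟶? v) ⊎-dec (v ⟶? u))

  Connected : Set
  Connected = ∀ u v → Star _∼_ u v

  IsComplete : Set
  IsComplete = ∀ u v → u ≢ v → u ∼ v

  data Row : Set where
    arcRow    : Arc → Row
    vertexRow : Fin n → Row

  data Column : Set where
    k : Column
    f : Fin n → Column

  ⟦_⟧ : ∀ {P : Set} → Dec P → ℤ
  ⟦ P? ⟧ = if does P? then 1ℤ else 0ℤ

  coefficientMatrix : Matrix Row Column
  coefficientMatrix (arcRow (arc u v _)) k     = 0ℤ
  coefficientMatrix (arcRow (arc u v _)) (f x) = ⟦ v ∼? x ⟧ - ⟦ u ∼? x ⟧
  coefficientMatrix (vertexRow v)        k     = 1ℤ
  coefficientMatrix (vertexRow v)        (f x) = - ⟦ v ≟ x ⟧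

{-# OPTIONS --safe #-}
-- If u and w are non-adjacent with a common neighbour b, then the row of the
-- arc between u and b together with the vertex rows of u and w has determinant
-- ±2 in the columns k, f u, f w. Hence total unimodularity makes adjacency
-- transitive on distinct vertices, and connectedness makes it complete.
--
-- Conversely, if G(D) is complete then every row has one entry 1 and one entry
-- -1, so M is the incidence matrix of a digraph on the columns. A square
-- submatrix is handled by contracting the edge given by its first row, which
-- yields a smaller matrix of the same shape and, up to sign, the same
-- determinant.
module Submission where

open import Defs
open import Data.Integer.Properties
  using (+-0-commutativeMonoid; +-*-semiring; +-identityˡ; +-identityʳ; *-identityˡ; *-zeroˡ; *-zeroʳ; +-inverseʳ)
open import Algebra.Properties.CommutativeMonoid.Sum +-0-commutativeMonoid
  using (sum; sum-cong-≗; sum-remove; sum-replicate-zero; ∑-distrib-+)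
open import Algebra.Properties.Semiring.Sum +-*-semiring
  using (*-distribˡ-sum)
open import Data.Bool.Base using (if_then_else_; true; false)
open import Data.Fin.Base using (Fin; zero; suc; toℕ; punchIn; punchOut; pinch)
open import Data.Fin.Properties as Fin using (punchIn-injective; punchInᵢ≢i; punchIn-punchOut; suc-injective; any?)
open import Data.Fin.Patterns using (0F; 1F; 2F)
open import Data.Integer.Base using (ℤ; 0ℤ; 1ℤ; -1ℤ; +_; -[1+_]; _+_; _*_; _-_; -_; _^_)
open import Data.Integer.Tactic.RingSolver using (solve-∀)
open import Data.Nat.Base using (ℕ; zero; suc)
open import Data.Product.Base using (_,_)
open import Data.Sum.Base using (_⊎_; inj₁; inj₂)
open import Function.Base using (_∘_)
open import Function.Bundles using (_⇔_; mk⇔)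
open import Function.Definitions using (Injective)
open import Relation.Binary.Definitions using (DecidableEquality)
open import Relation.Binary.PropositionalEquality
open import Relation.Binary.Construct.Closure.Symmetric using (fwd; bwd; symmetric)
open import Relation.Binary.Construct.Closure.ReflexiveTransitive using (Star; ε; _◅_)
open import Relation.Binary.Construct.Closure.Transitive using ([_])
open import Relation.Nullary using (¬_; yes; no; does; contradiction)
open import Relation.Nullary.Decidable using (dec-true; dec-false; map′)

open ≡-Reasoning

-- Laplace expansion and additivity of the determinant in the first column.

sign : ∀ {n} → Fin n → ℤ
sign j = -1ℤ ^ toℕ j

minor : ∀ {n} → Matrix (Fin (suc n)) (Fin (suc n)) → Fin (suc n) → Matrix (Fin n) (Fin n)
minor A j i l = A (suc i) (punchIn j l)

det-cong : ∀ {n} {A B : Matrix (Fin n) (Fin n)} → (∀ i j → A i j ≡ B i j) → det A ≡ det B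
det-cong {zero}          A≗B = refl
det-cong {suc n} {A} {B} A≗B = sum-cong-≗ λ j →
  cong₂ (λ a d → sign j * a * d) (A≗B zero j) (det-cong λ i l → A≗B (suc i) (punchIn j l))

sum-zero : ∀ {n} (t : Fin n → ℤ) → (∀ j → t j ≡ 0ℤ) → sum t ≡ 0ℤ
sum-zero {n} t t≗0 = trans (sum-cong-≗ t≗0) (sum-replicate-zero n)

laplace-term-zero : ∀ {a} s d → a ≡ 0ℤ → s * a * d ≡ 0ℤ
laplace-term-zero s d refl = trans (cong (_* d) (*-zeroʳ s)) (*-zeroˡ d)

det-zero-row : ∀ {n} (A : Matrix (Fin (suc n)) (Fin (suc n))) →
               (∀ j → A zero j ≡ 0ℤ) → det A ≡ 0ℤ
det-zero-row A A₀≗0 =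
  sum-zero (λ j → sign j * A zero j * det (minor A j)) λ j → laplace-term-zero (sign j) _ (A₀≗0 j)

det-single-entry : ∀ {n} (A : Matrix (Fin (suc n)) (Fin (suc n))) →
                   (∀ j → A zero (suc j) ≡ 0ℤ) → det A ≡ A zero zero * det (minor A zero)
det-single-entry A A₀≗0 = begin
  1ℤ * A zero zero * d + _ ≡⟨ cong₂ _+_ (cong (_* d) (*-identityˡ (A zero zero)))
                                (sum-zero (λ j → sign (suc j) * A zero (suc j) * det (minor A (suc j)))
                                  λ j → laplace-term-zero (sign (suc j)) _ (A₀≗0 j)) ⟩
  A zero zero * d + 0ℤ     ≡⟨ +-identityʳ _ ⟩
  A zero zero * d          ∎
  where d = det (minor A zero)

-- Term `zero` of the expansion splits because its entry does, its minor being the same for all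
-- three matrices. In every other term the entry is shared and the minor still contains column
-- `zero`, so induction splits the minor.
det-column₀-+ : ∀ {n} (A B C : Matrix (Fin (suc n)) (Fin (suc n))) →
                (∀ i → C i zero ≡ A i zero + B i zero) →
                (∀ i j → C i (suc j) ≡ A i (suc j)) → (∀ i j → C i (suc j) ≡ B i (suc j)) →
                det C ≡ det A + det B
det-column₀-+ {n} A B C C₀≗A₀+B₀ C≗A C≗B = begin
  det C                                       ≡⟨ cong₂ _+_ first (sum-cong-≗ other) ⟩
  tA zero + tB zero + sum (λ j → tA (suc j) + tB (suc j))
                                              ≡⟨ cong (λ x → tA zero + tB zero + x) (∑-distrib-+ (tA ∘ suc) (tB ∘ suc)) ⟩
  tA zero + tB zero + (sum (tA ∘ suc) + sum (tB ∘ suc))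
                                              ≡⟨ interchange (tA zero) (tB zero) (sum (tA ∘ suc)) (sum (tB ∘ suc)) ⟩
  det A + det B                               ∎
  where
  tA tB : Fin (suc n) → ℤ
  tA j = sign j * A zero j * det (minor A j)
  tB j = sign j * B zero j * det (minor B j)

  interchange : ∀ a b c d → a + b + (c + d) ≡ a + c + (b + d)
  interchange = solve-∀

  distrib₁ : ∀ a b d → 1ℤ * (a + b) * d ≡ 1ℤ * a * d + 1ℤ * b * d
  distrib₁ = solve-∀

  distrib₂ : ∀ s c d e → s * c * (d + e) ≡ s * c * d + s * c * e
  distrib₂ = solve-∀

  first : 1ℤ * C zero zero * det (minor C zero) ≡ tA zero + tB zero
  first = begin
    1ℤ * C zero zero * det (minor C zero)
      ≡⟨ cong (λ c → 1ℤ * c * det (minor C zero)) (C₀≗A₀+B₀ zero) ⟩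
    1ℤ * (A zero zero + B zero zero) * det (minor C zero)
      ≡⟨ distrib₁ (A zero zero) (B zero zero) (det (minor C zero)) ⟩
    1ℤ * A zero zero * det (minor C zero) + 1ℤ * B zero zero * det (minor C zero)
      ≡⟨ cong₂ (λ d e → 1ℤ * A zero zero * d + 1ℤ * B zero zero * e)
           (det-cong λ i j → C≗A (suc i) j) (det-cong λ i j → C≗B (suc i) j) ⟩
    tA zero + tB zero ∎

  -- Stated for every size so that `n` can be matched on: an element of `Fin n` forces `n` to be a
  -- successor, and only then do the minors have a first column.
  minors : ∀ {n} (A B C : Matrix (Fin (suc n)) (Fin (suc n))) →
           (∀ i → C i zero ≡ A i zero + B i zero) →
           (∀ i j → C i (suc j) ≡ A i (suc j)) → (∀ i j → C i (suc j) ≡ B i (suc j)) →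
           ∀ (j : Fin n) →
           det (minor C (suc j)) ≡ det (minor A (suc j)) + det (minor B (suc j))
  minors {suc n} A B C C₀≗A₀+B₀ C≗A C≗B j =
    det-column₀-+ (minor A (suc j)) (minor B (suc j)) (minor C (suc j))
      (C₀≗A₀+B₀ ∘ suc) (λ i l → C≗A (suc i) (punchIn j l)) (λ i l → C≗B (suc i) (punchIn j l))

  other : ∀ j → sign (suc j) * C zero (suc j) * det (minor C (suc j)) ≡ tA (suc j) + tB (suc j)
  other j = begin
    sign (suc j) * C zero (suc j) * det (minor C (suc j))
      ≡⟨ cong (sign (suc j) * C zero (suc j) *_) (minors A B C C₀≗A₀+B₀ C≗A C≗B j) ⟩
    sign (suc j) * C zero (suc j) * (det (minor A (suc j)) + det (minor B (suc j)))
      ≡⟨ distrib₂ (sign (suc j)) (C zero (suc j)) (det (minor A (suc j))) (det (minor B (suc j))) ⟩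
    sign (suc j) * C zero (suc j) * det (minor A (suc j)) + sign (suc j) * C zero (suc j) * det (minor B (suc j))
      ≡⟨ cong₂ (λ a b → sign (suc j) * a * det (minor A (suc j)) + sign (suc j) * b * det (minor B (suc j)))
           (C≗A zero j) (C≗B zero j) ⟩
    tA (suc j) + tB (suc j) ∎

-- Moving one column to the front.

-- The cycle that brings `p` to position `zero` and keeps the other positions in order; its
-- signature is `sign p`.
toFront : ∀ {n} → Fin n → Fin n → Fin n
toFront p zero    = p
toFront p (suc l) = punchIn p l

toFront-injective : ∀ {n} (p : Fin n) → Injective _≡_ _≡_ (toFront p)
toFront-injective p {zero}  {zero}  _  = refl
toFront-injective p {zero}  {suc l} eq = contradiction (sym eq) (punchInᵢ≢i p l)
toFront-injective p {suc j} {zero}  eq = contradiction eq (punchInᵢ≢i p j)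
toFront-injective p {suc j} {suc l} eq = cong suc (punchIn-injective p j l eq)

-- After the move, position `suc l` holds the original column `punchIn p l`. Once that column is
-- deleted, `p` sits at position `pinch l p`, so moving and deleting commute with this shift of
-- index.
punchIn-toFront-pinch : ∀ {n} (p : Fin (suc n)) (l x : Fin n) →
  toFront p (punchIn (suc l) x) ≡ punchIn (punchIn p l) (toFront (pinch l p) x)
punchIn-toFront-pinch p l zero    = at-front p l
  where
  at-front : ∀ {n} (p : Fin (suc n)) (l : Fin n) → p ≡ punchIn (punchIn p l) (pinch l p)
  at-front zero    zero    = refl
  at-front zero    (suc l) = refl
  at-front (suc p) zero    = refl
  at-front (suc p) (suc l) = cong suc (at-front p l)
punchIn-toFront-pinch p l (suc x) = behind p l x
  where
  behind : ∀ {n} (p : Fin (suc (suc n))) (l : Fin (suc n)) (x : Fin n) →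
           punchIn p (punchIn l x) ≡ punchIn (punchIn p l) (punchIn (pinch l p) x)
  behind zero    zero    x       = refl
  behind zero    (suc l) x       = refl
  behind (suc p) zero    x       = refl
  behind (suc p) (suc l) zero    = refl
  behind (suc p) (suc l) (suc x) = cong suc (behind p l x)

-- If `p` is at most `l`, the two indices on the left are `l + 1` and `p`; otherwise they are `l`
-- and `p - 1`. Either way the sum has the parity of `p + l + 1`.
sign-punchIn-pinch : ∀ {n} (p : Fin (suc n)) (l : Fin n) →
  sign (punchIn p l) * sign (pinch l p) ≡ sign p * sign (suc l)
sign-punchIn-pinch zero    zero    = refl
sign-punchIn-pinch zero    (suc l) = commute (sign l)
  where
  commute : ∀ a → -1ℤ * (-1ℤ * a) * 1ℤ ≡ 1ℤ * (-1ℤ * (-1ℤ * a))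
  commute = solve-∀
sign-punchIn-pinch (suc p) zero    = commute (sign p)
  where
  commute : ∀ a → 1ℤ * a ≡ -1ℤ * a * (-1ℤ * 1ℤ)
  commute = solve-∀
sign-punchIn-pinch (suc p) (suc l) = begin
  -1ℤ * sign (punchIn p l) * (-1ℤ * sign (pinch l p)) ≡⟨ cancel (sign (punchIn p l)) (sign (pinch l p)) ⟩
  sign (punchIn p l) * sign (pinch l p)               ≡⟨ sign-punchIn-pinch p l ⟩
  sign p * sign (suc l)                               ≡⟨ cancel (sign p) (sign (suc l)) ⟨
  -1ℤ * sign p * (-1ℤ * sign (suc l))                 ∎
  where
  cancel : ∀ a b → -1ℤ * a * (-1ℤ * b) ≡ a * b
  cancel = solve-∀

-- Term `p` of the first expansion is matched with term `zero` of the second, and term `punchIn p l`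
-- with term `suc l`. For the latter, induction moves column `p` to the front of the minor.
det-toFront : ∀ {n} (A : Matrix (Fin n) (Fin n)) (p : Fin n) →
              det A ≡ sign p * det (λ i j → A i (toFront p j))
det-toFront {suc n} A p = begin
  sum t                                          ≡⟨ sum-remove {i = p} t ⟩
  t p + sum (λ l → t (punchIn p l))              ≡⟨ cong₂ _+_ (regroup (sign p) (A zero p) _) (sum-cong-≗ term) ⟩
  sign p * t′ zero + sum (λ l → sign p * t′ (suc l))
                                                 ≡⟨ cong (λ x → sign p * t′ zero + x) (*-distribˡ-sum (sign p) (t′ ∘ suc)) ⟨
  sign p * t′ zero + sign p * sum (t′ ∘ suc)     ≡⟨ distrib (sign p) (t′ zero) _ ⟩
  sign p * sum t′                                ∎
  where
  A′ : Matrix (Fin (suc n)) (Fin (suc n))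
  A′ i j = A i (toFront p j)

  t t′ : Fin (suc n) → ℤ
  t j  = sign j * A zero j * det (minor A j)
  t′ j = sign j * A′ zero j * det (minor A′ j)

  regroup : ∀ s a d → s * a * d ≡ s * (1ℤ * a * d)
  regroup = solve-∀

  distrib : ∀ s a b → s * a + s * b ≡ s * (a + b)
  distrib = solve-∀

  exchange : ∀ s s′ a d → s * a * (s′ * d) ≡ s * s′ * (a * d)
  exchange = solve-∀

  assoc : ∀ s s′ a d → s * s′ * (a * d) ≡ s * (s′ * a * d)
  assoc = solve-∀

  term : ∀ l → t (punchIn p l) ≡ sign p * t′ (suc l)
  term l = begin
    sign q * a * det (minor A q)
      ≡⟨ cong (sign q * a *_) (det-toFront (minor A q) (pinch l p)) ⟩
    sign q * a * (sign (pinch l p) * det (λ i x → minor A q i (toFront (pinch l p) x)))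
      ≡⟨ cong (λ d → sign q * a * (sign (pinch l p) * d))
           (det-cong λ i x → cong (A (suc i)) (punchIn-toFront-pinch p l x)) ⟨
    sign q * a * (sign (pinch l p) * det (minor A′ (suc l)))
      ≡⟨ exchange (sign q) (sign (pinch l p)) a _ ⟩
    sign q * sign (pinch l p) * (a * det (minor A′ (suc l)))
      ≡⟨ cong (_* (a * det (minor A′ (suc l)))) (sign-punchIn-pinch p l) ⟩
    sign p * sign (suc l) * (a * det (minor A′ (suc l)))
      ≡⟨ assoc (sign p) (sign (suc l)) a _ ⟩
    sign p * t′ (suc l) ∎
    where
    q = punchIn p l
    a = A zero q

-- Determinants with value -1, 0 or 1.

IsSign : ℤ → Set
IsSign d = d ≡ -1ℤ ⊎ d ≡ 0ℤ ⊎ d ≡ 1ℤ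

*-isSign : ∀ {a b} → IsSign a → IsSign b → IsSign (a * b)
*-isSign (inj₁ refl)        (inj₁ refl)        = inj₂ (inj₂ refl)
*-isSign (inj₁ refl)        (inj₂ (inj₁ refl)) = inj₂ (inj₁ refl)
*-isSign (inj₁ refl)        (inj₂ (inj₂ refl)) = inj₁ refl
*-isSign {b = b} (inj₂ (inj₁ refl)) _           = inj₂ (inj₁ (*-zeroˡ b))
*-isSign (inj₂ (inj₂ refl)) b                  = subst IsSign (sym (*-identityˡ _)) b

sign-isSign : ∀ {n} (p : Fin n) → IsSign (sign p)
sign-isSign zero    = inj₂ (inj₂ refl)
sign-isSign (suc p) = *-isSign (inj₁ refl) (sign-isSign p)

toFront-isSign : ∀ {n} (A : Matrix (Fin n) (Fin n)) (p : Fin n) →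
                 IsSign (det (λ i j → A i (toFront p j))) → IsSign (det A)
toFront-isSign A p d = subst IsSign (sym (det-toFront A p)) (*-isSign (sign-isSign p) d)

-- Incidence matrices of digraphs are totally unimodular.

module Incidence {C : Set} (_≟_ : DecidableEquality C) where

  δ : C → C → ℤ
  δ x y = if does (x ≟ y) then 1ℤ else 0ℤ

  δ-≡ : ∀ {x y} → x ≡ y → δ x y ≡ 1ℤ
  δ-≡ {x} {y} x≡y = cong (if_then 1ℤ else 0ℤ) (dec-true (x ≟ y) x≡y)

  δ-≢ : ∀ {x y} → x ≢ y → δ x y ≡ 0ℤ
  δ-≢ {x} {y} x≢y = cong (if_then 1ℤ else 0ℤ) (dec-false (x ≟ y) x≢y)

  -- Row `i` is an arc between `s i` and `t i`. Loops are allowed and give zero rows, since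
  -- contraction can turn parallel arcs into loops.
  incidence : ∀ {R : Set} → (R → C) → (R → C) → Matrix R C
  incidence s t i c = δ (s i) c - δ (t i) c

  incidence-zero : ∀ {R : Set} (s t : R → C) {i c} → s i ≢ c → t i ≢ c → incidence s t i c ≡ 0ℤ
  incidence-zero s t s≢c t≢c = cong₂ _-_ (δ-≢ s≢c) (δ-≢ t≢c)

  incidence-isSign : ∀ {R : Set} (s t : R → C) i c → IsSign (incidence s t i c)
  incidence-isSign s t i c with does (s i ≟ c) | does (t i ≟ c)
  ... | true  | true  = inj₂ (inj₁ refl)
  ... | true  | false = inj₂ (inj₂ refl)
  ... | false | true  = inj₁ refl
  ... | false | false = inj₂ (inj₁ refl)

  relabel : C → C → C → C
  relabel p q x = if does (x ≟ p) then q else x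

  δ-relabel-target : ∀ {p q} x → p ≢ q → δ (relabel p q x) q ≡ δ x q + δ x p
  δ-relabel-target {p} {q} x p≢q with x ≟ p
  ... | yes refl = trans (δ-≡ {q} refl) (sym (cong (_+ 1ℤ) (δ-≢ p≢q)))
  ... | no  _    = sym (+-identityʳ _)

  δ-relabel-other : ∀ {p q y} x → y ≢ p → y ≢ q → δ (relabel p q x) y ≡ δ x y
  δ-relabel-other {p} {q} {y} x y≢p y≢q with x ≟ p
  ... | yes refl = trans (δ-≢ (y≢q ∘ sym)) (sym (δ-≢ (y≢p ∘ sym)))
  ... | no  _    = refl

  -- The two surviving minors agree outside their first columns, and the sum of
  -- these columns is the column of the vertex obtained by gluing the endpoints.
  det-contract : ∀ {m} (s t c : Fin (suc (suc m)) → C) → Injective _≡_ _≡_ c →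
    s zero ≡ c zero → t zero ≡ c (suc zero) →
    let ρ = relabel (c zero) (c (suc zero)) in
    det (λ i j → incidence s t i (c j)) ≡
    det (λ i j → incidence (ρ ∘ s ∘ suc) (ρ ∘ t ∘ suc) i (c (suc j)))
  det-contract {m} s t c c-inj s₀≡c₀ t₀≡c₁ = begin
    1ℤ * A zero zero * d₀ + (-1ℤ * 1ℤ * A zero (suc zero) * d₁ + sum rest)
      ≡⟨ cong₂ (λ a b → 1ℤ * a * d₀ + (-1ℤ * 1ℤ * b * d₁ + sum rest)) A₀₀ A₀₁ ⟩
    1ℤ * 1ℤ * d₀ + (-1ℤ * 1ℤ * -1ℤ * d₁ + sum rest)
      ≡⟨ cong (λ r → 1ℤ * 1ℤ * d₀ + (-1ℤ * 1ℤ * -1ℤ * d₁ + r)) (sum-zero rest rest≗0) ⟩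
    1ℤ * 1ℤ * d₀ + (-1ℤ * 1ℤ * -1ℤ * d₁ + 0ℤ)
      -- The entry -1 cancels the Laplace sign of column 1, so the two minors are added.
      ≡⟨ simplify d₀ d₁ ⟩
    d₀ + d₁
      ≡⟨ det-column₀-+ (minor A zero) (minor A (suc zero)) merged merged₀ merged₊ merged₊ ⟨
    det merged ∎
    where
    ρ = relabel (c zero) (c (suc zero))

    A : Matrix (Fin (suc (suc m))) (Fin (suc (suc m)))
    A i j = incidence s t i (c j)

    merged : Matrix (Fin (suc m)) (Fin (suc m))
    merged i j = incidence (ρ ∘ s ∘ suc) (ρ ∘ t ∘ suc) i (c (suc j))

    d₀ = det (minor A zero)
    d₁ = det (minor A (suc zero))

    rest : Fin m → ℤ
    rest j = sign (suc (suc j)) * A zero (suc (suc j)) * det (minor A (suc (suc j)))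

    c-≢ : ∀ {i j} → i ≢ j → c i ≢ c j
    c-≢ i≢j = i≢j ∘ c-inj

    A₀₀ : A zero zero ≡ 1ℤ
    A₀₀ = cong₂ _-_ (δ-≡ s₀≡c₀) (δ-≢ λ t₀≡c₀ → c-≢ (λ ()) (trans (sym t₀≡c₁) t₀≡c₀))

    A₀₁ : A zero (suc zero) ≡ -1ℤ
    A₀₁ = cong₂ _-_ (δ-≢ λ s₀≡c₁ → c-≢ (λ ()) (trans (sym s₀≡c₀) s₀≡c₁)) (δ-≡ t₀≡c₁)

    rest≗0 : ∀ j → rest j ≡ 0ℤ
    rest≗0 j = laplace-term-zero (sign (suc (suc j))) _ (incidence-zero s t
      (λ s₀≡c → c-≢ (λ ()) (trans (sym s₀≡c₀) s₀≡c))
      (λ t₀≡c → c-≢ (λ ()) (trans (sym t₀≡c₁) t₀≡c)))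

    simplify : ∀ a b → 1ℤ * 1ℤ * a + (-1ℤ * 1ℤ * -1ℤ * b + 0ℤ) ≡ a + b
    simplify = solve-∀

    interchange : ∀ a b c d → a + b - (c + d) ≡ a - c + (b - d)
    interchange = solve-∀

    -- Deleting column 0 leaves column 1 in front and deleting column 1 leaves column 0 in front,
    -- hence the order of the summands.
    merged₀ : ∀ i → merged i zero ≡ A (suc i) (suc zero) + A (suc i) zero
    merged₀ i = trans
      (cong₂ _-_ (δ-relabel-target (s (suc i)) (c-≢ λ ())) (δ-relabel-target (t (suc i)) (c-≢ λ ())))
      (interchange (δ (s (suc i)) (c (suc zero))) (δ (s (suc i)) (c zero))
                   (δ (t (suc i)) (c (suc zero))) (δ (t (suc i)) (c zero)))

    merged₊ : ∀ i j → merged i (suc j) ≡ A (suc i) (suc (suc j))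
    merged₊ i j = cong₂ _-_ (δ-relabel-other (s (suc i)) (c-≢ λ ()) (c-≢ λ ()))
                            (δ-relabel-other (t (suc i)) (c-≢ λ ()) (c-≢ λ ()))

  -- Endpoints outside the range of c are allowed; they are simply not seen, so
  -- deleting a column leaves s and t unchanged.
  SignDet : ℕ → Set
  SignDet m = ∀ (s t c : Fin m → C) → Injective _≡_ _≡_ c →
              IsSign (det (λ i j → incidence s t i (c j)))

  -- The first row vanishes off column `p`. With that column in front, the expansion has one term,
  -- whose minor is again an incidence matrix, with the vertex `c p` no longer seen.
  single-endpoint : ∀ {m} → SignDet m → (s t c : Fin (suc m) → C) → Injective _≡_ _≡_ c →
    ∀ p → (∀ j → incidence s t zero (c (punchIn p j)) ≡ 0ℤ) →
    IsSign (det (λ i j → incidence s t i (c j)))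
  single-endpoint ih s t c c-inj p off-p =
    toFront-isSign (λ i j → incidence s t i (c j)) p (subst IsSign
      (sym (det-single-entry (λ i j → incidence s t i (c (toFront p j))) off-p))
      (*-isSign (incidence-isSign s t zero (c p))
        (ih (s ∘ suc) (t ∘ suc) (c ∘ punchIn p) (punchIn-injective p _ _ ∘ c-inj))))

  -- Two moves produce the order that `det-contract` expects. The first puts the column of `t zero`
  -- in front, which shifts that of `s zero` to `suc r`; the second brings the latter forward and
  -- leaves the former at position 1.
  two-endpoints : ∀ {m} → SignDet m → (s t c : Fin (suc m) → C) → Injective _≡_ _≡_ c →
    ∀ q (r : Fin m) → s zero ≡ c (punchIn q r) → t zero ≡ c q →
    IsSign (det (λ i j → incidence s t i (c j)))
  two-endpoints {suc m} ih s t c c-inj q r s₀≡ t₀≡ =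
    toFront-isSign (λ i j → incidence s t i (c j)) q (toFront-isSign (λ i j → incidence s t i (c (toFront q j))) (suc r)
      (subst IsSign (sym (det-contract s t c′ c′-inj s₀≡ t₀≡))
        (ih (ρ ∘ s ∘ suc) (ρ ∘ t ∘ suc) (c′ ∘ suc) (suc-injective ∘ c′-inj))))
    where
    c′ = c ∘ toFront q ∘ toFront (suc r)
    ρ  = relabel (c′ zero) (c′ (suc zero))

    c′-inj : Injective _≡_ _≡_ c′
    c′-inj = toFront-injective (suc r) ∘ toFront-injective q ∘ c-inj

  -- Induction on the size, split by which endpoints of the first arc occur among the chosen
  -- columns.
  signDet : ∀ m → SignDet m
  signDet zero    s t c c-inj = inj₂ (inj₂ refl)
  signDet (suc m) s t c c-inj
    with any? (λ j → s zero ≟ c j) | any? (λ j → t zero ≟ c j)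
  ... | no s∉ | no t∉ = inj₂ (inj₁ (det-zero-row (λ i j → incidence s t i (c j)) λ j →
        incidence-zero s t (λ e → s∉ (j , e)) (λ e → t∉ (j , e))))
  ... | yes (p , s≡) | no t∉ = single-endpoint (signDet m) s t c c-inj p λ j →
        incidence-zero s t (λ e → punchInᵢ≢i p j (c-inj (trans (sym e) s≡)))
                           (λ e → t∉ (_ , e))
  ... | no s∉ | yes (q , t≡) = single-endpoint (signDet m) s t c c-inj q λ j →
        incidence-zero s t (λ e → s∉ (_ , e))
                           (λ e → punchInᵢ≢i q j (c-inj (trans (sym e) t≡)))
  ... | yes (p , s≡) | yes (q , t≡) with q Fin.≟ p
  -- The first arc is a loop, so its two contributions cancel in every column.
  ...   | yes refl = inj₂ (inj₁ (det-zero-row (λ i j → incidence s t i (c j)) λ j →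
          trans (cong (λ x → δ x (c j) - δ (t zero) (c j)) (trans s≡ (sym t≡)))
                (+-inverseʳ (δ (t zero) (c j)))))
  ...   | no  q≢p  = two-endpoints (signDet m) s t c c-inj q (punchOut q≢p)
          (trans s≡ (cong c (sym (punchIn-punchOut q≢p)))) t≡

  incidence-totallyUnimodular : ∀ {R : Set} (s t : R → C) → TotallyUnimodular (incidence s t)
  incidence-totallyUnimodular s t m r c _ c-inj = signDet m (s ∘ r) (t ∘ r) c c-inj

-- Complete graphs give incidence matrices.

module _ {n} (D : DAG n) where
  open DAG D

  f-injective : ∀ {u v} → f u ≡ f v → u ≡ v
  f-injective refl = refl

  _≟ᶜ_ : DecidableEquality Column
  k   ≟ᶜ k   = yes refl
  k   ≟ᶜ f _ = no λ ()
  f _ ≟ᶜ k   = no λ ()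
  -- `map′` keeps the Boolean of `u Fin.≟ v`, so `δ (f u) (f v)` unfolds to the indicator used in
  -- the vertex rows.
  f u ≟ᶜ f v = map′ (cong f) f-injective (u Fin.≟ v)

  open Incidence _≟ᶜ_

  -- For an arc, the +1 belongs to the tail: in a complete graph `N(v)` minus `N(u)` contains only
  -- `u`, and `N(u)` minus `N(v)` only `v`.
  plus minus : Row → Column
  plus  (arcRow (arc u v _)) = f u
  plus  (vertexRow v)        = k
  minus (arcRow (arc u v _)) = f v
  minus (vertexRow v)        = f v

  ∼-irrefl : ∀ v → ¬ v ∼ v
  ∼-irrefl v (fwd v⟶v) = acyclic v [ v⟶v ]
  ∼-irrefl v (bwd v⟶v) = acyclic v [ v⟶v ]

  ⟦∼⟧≡1 : ∀ {u v} → u ∼ v → ⟦ u ∼? v ⟧ ≡ 1ℤ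
  ⟦∼⟧≡1 {u} {v} u∼v = cong (if_then 1ℤ else 0ℤ) (dec-true (u ∼? v) u∼v)

  ⟦≁⟧≡0 : ∀ {u v} → ¬ u ∼ v → ⟦ u ∼? v ⟧ ≡ 0ℤ
  ⟦≁⟧≡0 {u} {v} u≁v = cong (if_then 1ℤ else 0ℤ) (dec-false (u ∼? v) u≁v)

  -- Acyclicity excludes a loop at `v`, and completeness supplies every other neighbour.
  complete-∼ : IsComplete → ∀ v x → ⟦ v ∼? x ⟧ ≡ 1ℤ - δ (f v) (f x)
  complete-∼ complete v x with v Fin.≟ x
  ... | yes refl = ⟦≁⟧≡0 (∼-irrefl v)
  ... | no  v≢x  = ⟦∼⟧≡1 (complete v x v≢x)

  complete-incidence : IsComplete → ∀ i c → incidence plus minus i c ≡ coefficientMatrix i c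
  complete-incidence complete (arcRow (arc u v _)) k = refl
  complete-incidence complete (arcRow (arc u v _)) (f x) = begin
    δ (f u) (f x) - δ (f v) (f x)
      ≡⟨ complement (δ (f u) (f x)) (δ (f v) (f x)) ⟩
    (1ℤ - δ (f v) (f x)) - (1ℤ - δ (f u) (f x))
      ≡⟨ cong₂ _-_ (complete-∼ complete v x) (complete-∼ complete u x) ⟨
    ⟦ v ∼? x ⟧ - ⟦ u ∼? x ⟧ ∎
    where
    complement : ∀ a b → a - b ≡ (1ℤ - b) - (1ℤ - a)
    complement = solve-∀
  complete-incidence complete (vertexRow v) k     = refl
  complete-incidence complete (vertexRow v) (f x) = +-identityˡ _

  complete⇒totallyUnimodular : IsComplete → TotallyUnimodular coefficientMatrix
  complete⇒totallyUnimodular complete m r c r-inj c-inj =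
    subst IsSign (det-cong λ i j → complete-incidence complete (r i) (c j))
      (incidence-totallyUnimodular plus minus m r c r-inj c-inj)

  -- Non-adjacent vertices with a common neighbour, and completeness.

  module _ {u w : Fin n} (u≢w : u ≢ w) (a : Arc) where

    rows : Fin 3 → Row
    rows 0F = arcRow a
    rows 1F = vertexRow u
    rows 2F = vertexRow w

    columns : Fin 3 → Column
    columns 0F = k
    columns 1F = f u
    columns 2F = f w

    rows-injective : Injective _≡_ _≡_ rows
    rows-injective {0F} {0F} _ = refl
    rows-injective {1F} {1F} _ = refl
    rows-injective {2F} {2F} _ = refl
    rows-injective {1F} {2F} refl = contradiction refl u≢w
    rows-injective {2F} {1F} refl = contradiction refl u≢w
    rows-injective {0F} {1F} ()
    rows-injective {0F} {2F} ()
    rows-injective {1F} {0F} ()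
    rows-injective {2F} {0F} ()

    columns-injective : Injective _≡_ _≡_ columns
    columns-injective {0F} {0F} _ = refl
    columns-injective {1F} {1F} _ = refl
    columns-injective {2F} {2F} _ = refl
    columns-injective {1F} {2F} refl = contradiction refl u≢w
    columns-injective {2F} {1F} refl = contradiction refl u≢w
    columns-injective {0F} {1F} ()
    columns-injective {0F} {2F} ()
    columns-injective {1F} {0F} ()
    columns-injective {2F} {0F} ()

    -- The determinant is `2 * e`. Both orientations of the arc are covered by one matrix, with `e`
    -- equal to 1 or -1.
    obstruction : ℤ → Matrix (Fin 3) (Fin 3)
    obstruction e 0F 0F = 0ℤ
    obstruction e 0F (suc _) = e
    obstruction e (suc _) 0F = 1ℤ
    obstruction e 1F 1F = -1ℤ
    obstruction e 1F 2F = 0ℤ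
    obstruction e 2F 1F = 0ℤ
    obstruction e 2F 2F = -1ℤ

    submatrix-obstruction : ∀ {e} →
      coefficientMatrix (arcRow a) (f u) ≡ e → coefficientMatrix (arcRow a) (f w) ≡ e →
      ∀ i j → coefficientMatrix (rows i) (columns j) ≡ obstruction e i j
    submatrix-obstruction u≡e w≡e 0F 0F = refl
    submatrix-obstruction u≡e w≡e 0F 1F = u≡e
    submatrix-obstruction u≡e w≡e 0F 2F = w≡e
    submatrix-obstruction u≡e w≡e 1F 0F = refl
    submatrix-obstruction u≡e w≡e 2F 0F = refl
    submatrix-obstruction u≡e w≡e 1F 1F = cong -_ (δ-≡ {f u} refl)
    submatrix-obstruction u≡e w≡e 1F 2F = cong -_ (δ-≢ (u≢w ∘ f-injective))
    submatrix-obstruction u≡e w≡e 2F 1F = cong -_ (δ-≢ (u≢w ∘ sym ∘ f-injective))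
    submatrix-obstruction u≡e w≡e 2F 2F = cong -_ (δ-≡ {f w} refl)

    obstruction-isSign : TotallyUnimodular coefficientMatrix → ∀ {e} →
      coefficientMatrix (arcRow a) (f u) ≡ e → coefficientMatrix (arcRow a) (f w) ≡ e →
      IsSign (det (obstruction e))
    obstruction-isSign tu u≡e w≡e = subst IsSign (det-cong (submatrix-obstruction u≡e w≡e))
      (tu 3 rows columns rows-injective columns-injective)

  ∼-trans : TotallyUnimodular coefficientMatrix → ∀ {u b w} → u ≢ w → u ∼ b → b ∼ w → u ∼ w
  ∼-trans tu {u} {b} {w} u≢w u∼b b∼w with u ∼? w
  ... | yes u∼w = u∼w
  ... | no  u≁w = contradiction u∼b λ
    -- Both `u` and `w` are neighbours of the head `b` and not of the tail `u`, so `e` is 1; the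
    -- reversed arc below negates both entries.
    { (fwd u⟶b) → 2∉ (obstruction-isSign u≢w (arc u b u⟶b) tu
        (cong₂ _-_ (⟦∼⟧≡1 b∼u) (⟦≁⟧≡0 (∼-irrefl u))) (cong₂ _-_ (⟦∼⟧≡1 b∼w) (⟦≁⟧≡0 u≁w)))
    ; (bwd b⟶u) → -2∉ (obstruction-isSign u≢w (arc b u b⟶u) tu
        (cong₂ _-_ (⟦≁⟧≡0 (∼-irrefl u)) (⟦∼⟧≡1 b∼u)) (cong₂ _-_ (⟦≁⟧≡0 u≁w) (⟦∼⟧≡1 b∼w)))
    }
    where
    b∼u = symmetric _⟶_ u∼b

    2∉ : ¬ IsSign (+ 2)
    2∉ (inj₂ (inj₁ ()))
    2∉ (inj₂ (inj₂ ()))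

    -2∉ : ¬ IsSign (-[1+ 1 ])
    -2∉ (inj₁ ())
    -2∉ (inj₂ (inj₁ ()))

  totallyUnimodular⇒complete : Connected → TotallyUnimodular coefficientMatrix → IsComplete
  totallyUnimodular⇒complete connected tu u v u≢v = collapse (connected u v) u≢v
    where
    -- The path is contracted from its far end: its tail becomes one edge from `b` to `v`, which
    -- `∼-trans` joins to the first edge. The case `b ≡ v` is separate because no vertex is adjacent
    -- to itself.
    collapse : ∀ {u v} → Star _∼_ u v → u ≢ v → u ∼ v
    collapse ε u≢u = contradiction refl u≢u
    collapse {u} {v} (_◅_ {j = b} u∼b path) u≢v with b Fin.≟ v
    ... | yes refl = u∼b
    ... | no  b≢v  = ∼-trans tu u≢v u∼b (collapse path b≢v)

theorem1 : ∀ (n : ℕ) (D : DAG n) → DAG.Connected D →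
    TotallyUnimodular (DAG.coefficientMatrix D) ⇔ DAG.IsComplete D
theorem1 n D connected =
  mk⇔ (totallyUnimodular⇒complete D connected) (complete⇒totallyUnimodular D)
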